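{- Let $A$ be a combinatorially rich set in $(\mathbb{N},+)$. Then (1) $A$ contains a family of $2^\omega$ almost disjoint subsets each of which is combinatorially rich; and (2) $A$ can be split into $\omega$ pairwise disjoint subsets each of which is combinatorially rich.
   Context: $\mathbb{N}=\{1,2,\dots\}$. For $n\in\mathbb{N}$ and a set $X$, $\mathcal{P}_n(X)$ is the set of $n$-element subsets of $X$, and ${}^mX$ is the set of sequences of length $m$ in $X$. For a commutative semigroup $(S,+)$, $L\in\mathcal{P}_n({}^mS)$, $a\in S$ and nonempty $H\subseteq\{1,\dots,m\}$, put $S_L(a,H)=\{a+\sum_{t\in H}f(t): f\in L\}$. A set $A\subseteq S$ is combinatorially rich if there is a sequence $\langle r_n\rangle_{n=1}^\infty$ in $\mathbb{N}$ such that for each $n\in\mathbb{N}$ and each $L\in\mathcal{P}_n({}^{r_n}S)$ there exist $a\in S$ and nonempty $H\subseteq\{1,\dots,r_n\}$ with $S_L(a,H)\subseteq A$. For an infinite set $X$, a family of almost disjoint subsets of $X$ is a family of subsets of $X$ each of cardinality $|X|$ such that any two distinct members intersect in a set of cardinality less than $|X|$. -}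

module Defs where

open import Algebra.Bundles using (CommutativeSemigroup)
open import Data.Bool.Base using (Bool)
open import Data.Fin.Base using (Fin)
open import Data.Fin.Subset using (Subset; Nonempty; inside; outside)
open import Data.Irrelevant using (Irrelevant; [_])
open import Data.Nat.Base using (ℕ; _+_; NonZero)
open import Data.Nat.Properties using (+-assoc; +-comm)
open import Data.Product.Base using (Σ-syntax; ∃-syntax; _×_; proj₁)
open import Data.Refinement using (Refinement; value; proof; value-injective)
open import Data.Vec.Base using (Vec; []; _∷_)
open import Data.Vec.Relation.Binary.Equality.Setoid using (≋-setoid)
open import Function.Bundles using (Injection; Bijection)
open import Level using (Level; 0ℓ; _⊔_)
open import Relation.Binary.Bundles using (Setoid)
import Relation.Binary.Construct.On as On
open import Relation.Binary.PropositionalEquality using (cong₂; isEquivalence; setoid; _→-setoid_)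
open import Relation.Nullary.Negation.Core using (¬_)
open import Relation.Unary using (Pred; _⊆_; _≐_; _∩_)
open import Relation.Unary.Relation.Binary.Equality using (≐-setoid)

private
  variable
    a b c p ℓ : Level

-- Positivity is proof-irrelevant, so _≡_ on ℕ⁺ is equality of values.
ℕ⁺ : Set
ℕ⁺ = Refinement ℕ NonZero

private
  +-nonZero : ∀ {m n} → Irrelevant (NonZero m) → Irrelevant (NonZero (m + n))
  +-nonZero {ℕ.suc m} _ = [ _ ]

infixl 6 _+⁺_

_+⁺_ : ℕ⁺ → ℕ⁺ → ℕ⁺
value (m +⁺ n) = value m + value n
proof (m +⁺ n) = +-nonZero (proof m)

ℕ⁺-setoid : Setoid 0ℓ 0ℓ
ℕ⁺-setoid = setoid ℕ⁺

ℕ⁺-+-commutativeSemigroup : CommutativeSemigroup 0ℓ 0ℓ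
ℕ⁺-+-commutativeSemigroup = record
  { _∙_ = _+⁺_
  ; isCommutativeSemigroup = record
    { isSemigroup = record
      { isMagma = record
        { isEquivalence = isEquivalence
        ; ∙-cong = cong₂ _+⁺_
        }
      ; assoc = λ x y z → value-injective (+-assoc (value x) (value y) (value z))
      }
    ; comm = λ x y → value-injective (+-comm (value x) (value y))
    }
  }

-- An n-element subset of X, given by an injective enumeration of its
-- members; only the range of the enumeration is used below.
𝒫 : ℕ → Setoid a b → Set (a ⊔ b)
𝒫 n X = Injection (setoid (Fin n)) X

module Richness (S : CommutativeSemigroup c ℓ) where

  open CommutativeSemigroup S renaming (setoid to S-setoid)

  Seq : ℕ → Setoid c (c ⊔ ℓ)
  Seq m = ≋-setoid S-setoid m

  -- x + Σ_{t∈H} f(t).  A semigroup has no empty sum, so the summation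
  -- is started from x.
  infixl 6 _+Σ[_]_

  _+Σ[_]_ : ∀ {m} → Carrier → Subset m → Vec Carrier m → Carrier
  x +Σ[ [] ]          []      = x
  x +Σ[ inside ∷ H ]  (y ∷ f) = (x ∙ y) +Σ[ H ] f
  x +Σ[ outside ∷ H ] (y ∷ f) = x +Σ[ H ] f

  translate : ∀ {n m} → 𝒫 n (Seq m) → Carrier → Subset m → Pred Carrier ℓ
  translate L x H s = ∃[ k ] s ≈ x +Σ[ H ] Injection.to L k

  CombinatoriallyRich : Pred Carrier p → Set (c ⊔ ℓ ⊔ p)
  CombinatoriallyRich A =
    Σ[ r ∈ (ℕ⁺ → ℕ⁺) ]
      ∀ (n : ℕ⁺) (L : 𝒫 (value n) (Seq (value (r n)))) →
        ∃[ x ] Σ[ H ∈ Subset (value (r n)) ] Nonempty H × translate L x H ⊆ A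

open Richness ℕ⁺-+-commutativeSemigroup public using (CombinatoriallyRich)

-- The subset P of X, with the equality inherited from X.
subset : (X : Setoid a b) → Pred (Setoid.Carrier X) p → Setoid (a ⊔ p) b
subset X P = On.setoid X (proj₁ {B = P})

-- Strict inequality of cardinalities, |X| < |Y|.
infix 4 _≺_

_≺_ : Setoid a b → Setoid c ℓ → Set (a ⊔ b ⊔ c ⊔ ℓ)
X ≺ Y = Injection X Y × ¬ Injection Y X

-- The setoid 2^ω.
2^ω : Setoid 0ℓ 0ℓ
2^ω = ℕ →-setoid Bool

-- A family of |I| almost disjoint subsets of the infinite set X.  The
-- indexing is injective up to extensional equality of subsets, so the
-- family has exactly |I| members.
record AlmostDisjointFamily (I : Setoid a b) (X : Setoid c ℓ) (p : Level)
       : Set (a ⊔ b ⊔ c ⊔ ℓ ⊔ Level.suc p) where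
  field
    family : Injection I (≐-setoid (Setoid.Carrier X) p)

  member : Setoid.Carrier I → Pred (Setoid.Carrier X) p
  member = Injection.to family

  field
    equinumerous    : ∀ x → Bijection (subset X (member x)) X
    almost-disjoint : ∀ x y → ¬ (member x ≐ member y) →
                      subset X (member x ∩ member y) ≺ X

{-# OPTIONS --safe #-}
module Submission where

-- In (ℕ,+) a combinatorially rich set stays rich, with the same r, when an
-- initial segment is removed: replacing every f ∈ L by f + N turns a solution
-- (x, H) into the solution (x + |H| N, H) for L.  There are only countably many
-- pairs (n, L), so A contains finite pieces P₀ < P₁ < …, lying in consecutive
-- intervals, such that P_⟨k,c⟩ solves the k-th pair for every label c.  Any set
-- containing, for each k, some P_⟨k,c⟩ is rich.  Colouring the intervals by
-- their labels splits A; taking for x ∈ 2^ω the pieces P_⟨k,c⟩ with c a code of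
-- x restricted to k gives the almost disjoint family.

open import Defs
open import Data.Bool.Base using (Bool; true; false; if_then_else_)
import Data.Bool.Properties as Bool
open import Data.Fin.Base using (Fin; zero; suc; toℕ; fromℕ<)
open import Data.Fin.Properties as Fin using (all?; pigeonhole; toℕ-injective; toℕ-fromℕ<)
open import Data.Fin.Subset using (Subset; Nonempty; inside; outside)
import Data.Fin.Subset as Subset
open import Data.Irrelevant using ([_])
open import Data.List.Base as List using (List; [])
open import Data.List.Extrema.Nat using (max; xs≤max)
open import Data.List.Membership.Propositional using (_∈_)
open import Data.List.Membership.Propositional.Properties using (∈-tabulate⁺; ∈-tabulate⁻; ∈-map⁺)
import Data.List.Membership.DecPropositional as DecMembership
import Data.List.Relation.Unary.All as All
open import Data.Nat.Base using (ℕ; zero; suc; pred; _+_; _⊔_; _≤_; _<_; z≤n; s≤s; s≤s⁻¹; ≢-nonZero⁻¹; _≤′_; ≤′-refl; ≤′-step)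
open import Data.Nat.Properties
open import Data.Product.Base using (Σ-syntax; ∃-syntax; _×_; _,_; proj₁; proj₂)
open import Data.Product.Properties using (,-injectiveˡ; ,-injectiveʳ)
open import Data.Refinement using (_,_; value; value-injective)
import Data.Refinement as Refinement
open import Data.Vec.Base using (Vec; []; _∷_; here; there; map; lookup; tabulate; replicate)
open import Data.Vec.Properties as Vec using (lookup∘tabulate; lookup-replicate; ∷-injective)
open import Data.Vec.Relation.Binary.Equality.Propositional using (≋⇒≡; ≡⇒≋)
open import Data.Sum.Base using (_⊎_; inj₁; inj₂)
open import Function.Base using (_∘_)
open import Function.Bundles using (Injection; Bijection; _↠_; mk↠ₛ; module Surjection)
open import Function.Construct.Composition using (_↠-∘_)
open import Function.Definitions using (Injective)
open import Relation.Binary.Definitions using (tri<; tri≈; tri>)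
open import Relation.Binary.PropositionalEquality using (_≡_; _≢_; refl; sym; trans; cong; cong₂; subst; module ≡-Reasoning)
open import Relation.Nullary using (¬_; yes; no; contradiction)
open import Relation.Nullary.Decidable using (map′; _×-dec_; _→-dec_; decidable-stable)
open import Relation.Nullary.Negation using (contradiction-irr)
open import Relation.Unary using (Pred; Decidable; _⊆_; _≐_; _⊥_; ⋃; _∩_)
open import Algebra.Properties.CommutativeSemigroup ℕ⁺-+-commutativeSemigroup using (x∙yz≈xz∙y; xy∙z≈xz∙y)

open Richness ℕ⁺-+-commutativeSemigroup using (Seq; _+Σ[_]_; translate)

pos : ℕ → ℕ⁺
pos n = suc n , [ _ ]

pos-pred : ∀ s → pos (pred (value s)) ≡ s
pos-pred (zero , [ p ])  = contradiction-irr refl (≢-nonZero⁻¹ 0 {{p}})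
pos-pred (suc n , _)     = value-injective refl

-- Sums over subsets

+Σ-+⁺ : ∀ {m} x y (H : Subset m) f → (x +⁺ y) +Σ[ H ] f ≡ (x +Σ[ H ] f) +⁺ y
+Σ-+⁺ x y []            []      = refl
+Σ-+⁺ x y (inside ∷ H)  (z ∷ f) =
  trans (cong (_+Σ[ H ] f) (xy∙z≈xz∙y x y z)) (+Σ-+⁺ (x +⁺ z) y H f)
+Σ-+⁺ x y (outside ∷ H) (z ∷ f) = +Σ-+⁺ x y H f

-- Each element of `H` contributes one `N`, and commutativity moves all of them to the starting
-- point. Summing the constant sequence over `H` expresses x + |H| N without a multiplication.
+Σ-shift : ∀ {m} x N (H : Subset m) f →
           x +Σ[ H ] map (_+⁺ N) f ≡ (x +Σ[ H ] replicate m N) +Σ[ H ] f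
+Σ-shift x N []            []      = refl
+Σ-shift {suc m} x N (inside ∷ H)  (y ∷ f) = begin
  (x +⁺ (y +⁺ N)) +Σ[ H ] map (_+⁺ N) f            ≡⟨ +Σ-shift _ N H f ⟩
  ((x +⁺ (y +⁺ N)) +Σ[ H ] Ns) +Σ[ H ] f           ≡⟨ cong (λ z → (z +Σ[ H ] Ns) +Σ[ H ] f) (x∙yz≈xz∙y x y N) ⟩
  (((x +⁺ N) +⁺ y) +Σ[ H ] Ns) +Σ[ H ] f           ≡⟨ cong (_+Σ[ H ] f) (+Σ-+⁺ (x +⁺ N) y H Ns) ⟩
  (((x +⁺ N) +Σ[ H ] Ns) +⁺ y) +Σ[ H ] f           ∎
  where
  open ≡-Reasoning
  Ns = replicate m N
+Σ-shift x N (outside ∷ H) (y ∷ f) = +Σ-shift x N H f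

x≤x+Σ : ∀ {m} x (H : Subset m) f → value x ≤ value (x +Σ[ H ] f)
x≤x+Σ x []            []      = ≤-refl
x≤x+Σ x (inside ∷ H)  (y ∷ f) = ≤-trans (m≤m+n (value x) (value y)) (x≤x+Σ (x +⁺ y) H f)
x≤x+Σ x (outside ∷ H) (y ∷ f) = x≤x+Σ x H f

lookup≤x+Σ : ∀ {m} x {H : Subset m} f {i} → i Subset.∈ H →
             value (lookup f i) ≤ value (x +Σ[ H ] f)
lookup≤x+Σ x {_ ∷ H}       (y ∷ f) here = ≤-trans (m≤n+m (value y) (value x)) (x≤x+Σ (x +⁺ y) H f)
lookup≤x+Σ x {inside ∷ H}  (y ∷ f) (there i∈H) = lookup≤x+Σ (x +⁺ y) f i∈H
lookup≤x+Σ x {outside ∷ H} (y ∷ f) (there i∈H) = lookup≤x+Σ x f i∈H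

-- Solutions above a given bound

map-injective : ∀ {a b} {X : Set a} {Y : Set b} {f : X → Y} → Injective _≡_ _≡_ f →
                ∀ {n} → Injective _≡_ _≡_ (map {n = n} f)
map-injective inj {_} {[]}     {[]}     eq = refl
map-injective inj {_} {x ∷ xs} {y ∷ ys} eq with fx≡fy , eqs ← ∷-injective eq =
  cong₂ _∷_ (inj fx≡fy) (map-injective inj eqs)

+⁺-cancelʳ : ∀ N → Injective _≡_ _≡_ (_+⁺ N)
+⁺-cancelʳ N {x} {y} eq = value-injective (+-cancelʳ-≡ (value N) (value x) (value y) (cong value eq))

-- Cancellation keeps the n shifted sequences distinct, so richness applies to them with the same n.
𝒫-shift : ∀ {n m} → ℕ⁺ → 𝒫 n (Seq m) → 𝒫 n (Seq m)
𝒫-shift N L = record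
  { to        = λ j → map (_+⁺ N) (Injection.to L j)
  ; cong      = λ { refl → ≡⇒≋ refl }
  ; injective = λ eq → Injection.injective L (≡⇒≋ (map-injective (+⁺-cancelʳ N) (≋⇒≡ eq)))
  }

rich⇒solution≥ : ∀ {ℓ} {P : Pred ℕ⁺ ℓ} (rich : CombinatoriallyRich P) →
  ∀ n (L : 𝒫 (value n) (Seq (value (proj₁ rich n)))) N →
  ∃[ x ] Σ[ H ∈ Subset _ ] Nonempty H × translate L x H ⊆ (λ s → P s × N ≤ value s)
rich⇒solution≥ {P = P} (r , solve) n L N with solve n (𝒫-shift (pos N) L)
... | x , H , H≢∅@(i , i∈H) , ⊆P = x′ , H , H≢∅ , bound
  where
  x′ = x +Σ[ H ] replicate _ (pos N)

  N≤x′ : N ≤ value x′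
  -- The shift is by N + 1, which is positive even for N = 0. Since `H` is nonempty, at least one
  -- such summand occurs in `x′`.
  N≤x′ = ≤-trans (n≤1+n N)
    (subst (λ z → value z ≤ value x′) (lookup-replicate i (pos N))
      (lookup≤x+Σ x {H} (replicate _ (pos N)) i∈H))

  bound : translate L x′ H ⊆ (λ s → P s × N ≤ value s)
  bound (j , refl) =
    ⊆P (j , sym (+Σ-shift x (pos N) H (Injection.to L j))) ,
    ≤-trans N≤x′ (x≤x+Σ x′ H (Injection.to L j))

𝒫-singleton : ∀ {m} → Vec ℕ⁺ m → 𝒫 1 (Seq m)
𝒫-singleton f = record
  { to        = λ _ → f
  ; cong      = λ _ → ≡⇒≋ refl
  ; injective = λ { {zero} {zero} _ → refl }
  }

-- A solution above N for any one-element family has a member, and the constant sequence 1 supplies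
-- such a family.
rich⇒unbounded : ∀ {ℓ} {P : Pred ℕ⁺ ℓ} → CombinatoriallyRich P →
                 ∀ N → ∃[ s ] P s × N ≤ value s
rich⇒unbounded rich N
  with x , H , _ , ⊆P ← rich⇒solution≥ rich (pos 0) (𝒫-singleton (replicate _ (pos 0))) N =
  _ , ⊆P (zero , refl)

-- The Cantor pairing

triangle : ℕ → ℕ
triangle zero    = zero
triangle (suc n) = suc n + triangle n

pair : ℕ × ℕ → ℕ
pair (a , b) = triangle (a + b) + b

-- The order in which `pair` counts: up each diagonal by the second component, then on to the next
-- diagonal. Iterating it inverts `pair` without any search.
next : ℕ × ℕ → ℕ × ℕ
next (zero , b)  = suc b , zero
next (suc a , b) = a , suc b

unpair : ℕ → ℕ × ℕ
unpair zero    = zero , zero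
unpair (suc k) = next (unpair k)

pair-next : ∀ p → pair (next p) ≡ suc (pair p)
pair-next (zero , b)  = begin
  triangle (suc b + 0) + 0 ≡⟨ +-identityʳ _ ⟩
  triangle (suc b + 0)     ≡⟨ cong triangle (+-identityʳ (suc b)) ⟩
  suc (b + triangle b)     ≡⟨ cong suc (+-comm b (triangle b)) ⟩
  suc (triangle b + b)     ∎
  where open ≡-Reasoning
pair-next (suc a , b) = begin
  triangle (a + suc b) + suc b   ≡⟨ +-suc _ b ⟩
  suc (triangle (a + suc b) + b) ≡⟨ cong (λ n → suc (triangle n + b)) (+-suc a b) ⟩
  suc (triangle (suc a + b) + b) ∎
  where open ≡-Reasoning

pair∘unpair : ∀ k → pair (unpair k) ≡ k
pair∘unpair zero    = refl
pair∘unpair (suc k) = trans (pair-next (unpair k)) (cong suc (pair∘unpair k))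

unpair∘pair : ∀ p → unpair (pair p) ≡ p
unpair∘pair (a , b) = along-diagonal (a + b) b a refl
  where
  step : ∀ p → unpair (pair p) ≡ p → unpair (pair (next p)) ≡ next p
  step p eq = trans (cong unpair (pair-next p)) (cong next eq)

  -- Every pair except (0, 0) is a value of `next`. The recursion goes down in b, and at b = 0 it
  -- passes to the last pair of the preceding diagonal.
  along-diagonal : ∀ s b a → a + b ≡ s → unpair (pair (a , b)) ≡ (a , b)
  along-diagonal s       (suc b) a       eq =
    step (suc a , b) (along-diagonal s b (suc a) (trans (sym (+-suc a b)) eq))
  along-diagonal (suc s) zero    (suc a) eq =
    step (zero , a) (along-diagonal s a zero (trans (sym (+-identityʳ a)) (suc-injective eq)))
  along-diagonal zero    zero    zero    eq = refl

pair-injective : Injective _≡_ _≡_ pair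
pair-injective {p} {q} eq = trans (sym (unpair∘pair p)) (trans (cong unpair eq) (unpair∘pair q))

-- Countability

ℕ↠ℕ⁺ : ℕ ↠ ℕ⁺
ℕ↠ℕ⁺ = mk↠ₛ {to = pos} λ s → pred (value s) , pos-pred s

-- Surjections suffice for countability here: repetitions in an enumeration do no harm.
ℕ↠Σ : ∀ {a b} {X : Set a} {Y : X → Set b} → ℕ ↠ X → (∀ x → ℕ ↠ Y x) → ℕ ↠ (Σ[ x ∈ X ] Y x)
ℕ↠Σ {X = X} {Y} e f = mk↠ₛ {to = enum ∘ unpair} reach
  where
  enum : ℕ × ℕ → Σ[ x ∈ X ] Y x
  enum (i , j) = Surjection.to e i , Surjection.to (f _) j

  reach : ∀ p → ∃[ k ] enum (unpair k) ≡ p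
  reach (x , y) with i , refl ← Surjection.strictlySurjective e x
                with j , refl ← Surjection.strictlySurjective (f (Surjection.to e i)) y =
    pair (i , j) , cong enum (unpair∘pair (i , j))

ℕ↠Vec : ∀ {a} {X : Set a} → ℕ ↠ X → ∀ n → ℕ ↠ Vec X n
ℕ↠Vec e zero    = mk↠ₛ {to = λ _ → []} λ { [] → 0 , refl }
ℕ↠Vec e (suc n) =
  mk↠ₛ {to = λ { (x , xs) → x ∷ xs }} (λ { (x ∷ xs) → (x , xs) , refl })
    ↠-∘ ℕ↠Σ e (λ _ → ℕ↠Vec e n)

-- Decidable unbounded subsets

module Rank {q} {Q : Pred ℕ q} (Q? : Decidable Q) where

  rank : ℕ → ℕ
  rank zero    = zero
  rank (suc n) with Q? n
  ... | yes _ = suc (rank n)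
  ... | no  _ = rank n

  rank-suc : ∀ {n} → Q n → rank (suc n) ≡ suc (rank n)
  rank-suc {n} q with Q? n
  ... | yes _ = refl
  ... | no ¬q = contradiction q ¬q

  rank≤rank-suc : ∀ n → rank n ≤ rank (suc n)
  rank≤rank-suc n with Q? n
  ... | yes _ = n≤1+n (rank n)
  ... | no  _ = ≤-refl

  rank-mono-≤′ : ∀ {m n} → m ≤′ n → rank m ≤ rank n
  rank-mono-≤′ ≤′-refl       = ≤-refl
  rank-mono-≤′ (≤′-step m≤n) = ≤-trans (rank-mono-≤′ m≤n) (rank≤rank-suc _)

  rank-mono-< : ∀ {m n} → Q m → m < n → rank m < rank n
  rank-mono-< q m<n = ≤-trans (≤-reflexive (sym (rank-suc q))) (rank-mono-≤′ (≤⇒≤′ m<n))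

  rank-injective : ∀ {m n} → Q m → Q n → rank m ≡ rank n → m ≡ n
  rank-injective {m} {n} qm qn eq with <-cmp m n
  ... | tri< m<n _ _ = contradiction eq (<⇒≢ (rank-mono-< qm m<n))
  ... | tri≈ _ m≡n _ = m≡n
  ... | tri> _ _ n<m = contradiction (sym eq) (<⇒≢ (rank-mono-< qn n<m))

  -- `rank` starts at 0 and grows by one exactly after each member of `Q`, so it skips no value.
  rank-hits : ∀ n {k} → k < rank n → ∃[ m ] Q m × rank m ≡ k
  rank-hits (suc n) k<r with Q? n
  ... | no  _ = rank-hits n k<r
  ... | yes q with m≤n⇒m<n∨m≡n (s≤s⁻¹ k<r)
  ...   | inj₁ k<rank = rank-hits n k<rank
  ...   | inj₂ refl   = n , q , refl

  rank-unbounded : (∀ N → ∃[ n ] Q n × N ≤ n) → ∀ k → ∃[ n ] k < rank n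
  rank-unbounded unb zero with n , q , _ ← unb 0 =
    suc n , ≤-trans (s≤s z≤n) (≤-reflexive (sym (rank-suc q)))
  rank-unbounded unb (suc k) with n , k<rank ← rank-unbounded unb k
                             with m , q , n≤m ← unb n =
    suc m , ≤-trans (s≤s (≤-trans k<rank (rank-mono-≤′ (≤⇒≤′ n≤m)))) (≤-reflexive (sym (rank-suc q)))

-- A member goes to one more than the number of smaller members. Decidability makes this count
-- computable.
unbounded⇒equinumerous : ∀ {ℓ} {P : Pred ℕ⁺ ℓ} → Decidable P →
  (∀ N → ∃[ s ] P s × N ≤ value s) → Bijection (subset ℕ⁺-setoid P) ℕ⁺-setoid
unbounded⇒equinumerous {P = P} P? unb = record
  { to        = λ (s , _) → pos (rank (pred (value s)))
  ; cong      = cong (λ s → pos (rank (pred (value s))))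
  ; bijective = (λ {(s , Ps)} {(t , Pt)} eq → inj s t Ps Pt eq) , surj
  }
  where
  open Rank (P? ∘ pos)

  P-pos : ∀ {s} → P s → P (pos (pred (value s)))
  P-pos {s} = subst P (sym (pos-pred s))

  inj : ∀ s t → P s → P t → pos (rank (pred (value s))) ≡ pos (rank (pred (value t))) → s ≡ t
  inj s t Ps Pt eq = trans (sym (pos-pred s)) (trans
    (cong pos (rank-injective (P-pos Ps) (P-pos Pt) (cong (pred ∘ value) eq)))
    (pos-pred t))

  unb-pos : ∀ N → ∃[ n ] P (pos n) × N ≤ n
  unb-pos N with s , Ps , N<s ← unb (suc N) = pred (value s) , P-pos Ps , pred-mono-≤ N<s

  surj : ∀ k → Σ[ s ∈ Σ[ s ∈ ℕ⁺ ] P s ]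
           (∀ {t : Σ[ t ∈ ℕ⁺ ] P t} → proj₁ t ≡ proj₁ s → pos (rank (pred (value (proj₁ t)))) ≡ k)
  surj k with n , k<r ← rank-unbounded unb-pos (pred (value k))
         with m , q , eq ← rank-hits n k<r =
    (pos m , q) , λ { refl → trans (cong pos eq) (pos-pred k) }

-- An injection would send the N + 1 numbers 1, ..., N + 1 to distinct values below N.
bounded⇒¬↣ : ∀ {ℓ} {P : Pred ℕ⁺ ℓ} N → (∀ {s} → P s → value s < N) →
             ¬ Injection ℕ⁺-setoid (subset ℕ⁺-setoid P)
bounded⇒¬↣ N bound g
  with i , j , i<j , eq ← pigeonhole (n<1+n N)
         (λ i → fromℕ< (bound (proj₂ (Injection.to g (pos (toℕ i)))))) =
  Fin.<⇒≢ i<j (toℕ-injective (cong (pred ∘ value) (Injection.injective g (value-injective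
    (trans (sym (toℕ-fromℕ< _)) (trans (cong toℕ eq) (toℕ-fromℕ< _)))))))

initial-values-bounded : ∀ (f : ℕ → ℕ) n → ∃[ N ] (∀ k → k < n → f k ≤ N)
initial-values-bounded f zero    = 0 , λ _ ()
initial-values-bounded f (suc n) with N , f≤N ← initial-values-bounded f n =
  f n ⊔ N , λ k k<1+n → case k (m≤n⇒m<n∨m≡n (s≤s⁻¹ k<1+n))
  where
  case : ∀ k → (k < n) ⊎ (k ≡ n) → f k ≤ f n ⊔ N
  case k (inj₁ k<n)  = ≤-trans (f≤N k k<n) (m≤n⊔m (f n) N)
  case k (inj₂ refl) = m≤m⊔n (f n) N

-- Intervals between the values of a strictly increasing sequence

module Intervals (b : ℕ → ℕ) (b₀≡0 : b 0 ≡ 0) (b-step : ∀ i → b i < b (suc i)) where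

  mono-≤′ : ∀ {i j} → i ≤′ j → b i ≤ b j
  mono-≤′ ≤′-refl       = ≤-refl
  mono-≤′ (≤′-step i≤j) = ≤-trans (mono-≤′ i≤j) (<⇒≤ (b-step _))

  mono-≤ : ∀ {i j} → i ≤ j → b i ≤ b j
  mono-≤ = mono-≤′ ∘ ≤⇒≤′

  Between : ℕ → ℕ → Set
  Between i s = b i ≤ s × s < b (suc i)

  -- Induction on s: passing to s + 1 either stays in the interval or reaches the left end of the
  -- next one.
  search : ∀ s → ∃[ i ] Between i s
  search zero    = 0 , ≤-reflexive b₀≡0 , ≤-trans (s≤s z≤n) (b-step 0)
  search (suc s) with i , bᵢ≤s , s<bᵢ₊₁ ← search s with m≤n⇒m<n∨m≡n s<bᵢ₊₁
  ... | inj₁ 1+s<bᵢ₊₁ = i , m≤n⇒m≤1+n bᵢ≤s , 1+s<bᵢ₊₁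
  ... | inj₂ 1+s≡bᵢ₊₁ =
    suc i , ≤-reflexive (sym 1+s≡bᵢ₊₁) , subst (_< b (suc (suc i))) (sym 1+s≡bᵢ₊₁) (b-step (suc i))

  locate : ℕ → ℕ
  locate = proj₁ ∘ search

  locate-between : ∀ s → Between (locate s) s
  locate-between = proj₂ ∘ search

  between-unique : ∀ {i j s} → Between i s → Between j s → i ≡ j
  between-unique {i} {j} (bᵢ≤s , s<bᵢ₊₁) (bⱼ≤s , s<bⱼ₊₁) with <-cmp i j
  ... | tri< i<j _ _ = contradiction (<-≤-trans s<bᵢ₊₁ (≤-trans (mono-≤ i<j) bⱼ≤s)) (<-irrefl refl)
  ... | tri≈ _ i≡j _ = i≡j
  ... | tri> _ _ j<i = contradiction (<-≤-trans s<bⱼ₊₁ (≤-trans (mono-≤ j<i) bᵢ≤s)) (<-irrefl refl)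

  locate-unique : ∀ {i s} → Between i s → locate s ≡ i
  locate-unique = between-unique (locate-between _)

-- Coding of the finite initial segments of x ∈ 2^ω

bit : Bool → ℕ
bit b = if b then 1 else 0

bit-injective : Injective _≡_ _≡_ bit
bit-injective {true}  {true}  _ = refl
bit-injective {false} {false} _ = refl

-- The length k is not recorded in the code; codes are compared only at equal lengths.
prefix : (ℕ → Bool) → ℕ → ℕ
prefix x zero    = zero
prefix x (suc k) = pair (bit (x k) , prefix x k)

prefix-cong : ∀ {x y} → (∀ k → x k ≡ y k) → ∀ k → prefix x k ≡ prefix y k
prefix-cong eq zero    = refl
prefix-cong eq (suc k) = cong₂ (λ b c → pair (bit b , c)) (eq k) (prefix-cong eq k)

prefix-injective : ∀ {x y} k → prefix x k ≡ prefix y k → ∀ {j} → j < k → x j ≡ y j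
prefix-injective {x} {y} (suc k) eq j<1+k
  with m≤n⇒m<n∨m≡n (s≤s⁻¹ j<1+k) | pair-injective {bit (x k) , _} {bit (y k) , _} eq
... | inj₁ j<k  | eq′ = prefix-injective k (,-injectiveʳ eq′) j<k
... | inj₂ refl | eq′ = bit-injective (,-injectiveˡ eq′)

-- Finite pieces of a rich set

module Splitting {ℓ} {A : Pred ℕ⁺ ℓ} (rich : CombinatoriallyRich A) where

  r : ℕ⁺ → ℕ⁺
  r = proj₁ rich

  -- Vectors of sequences, possibly with repetitions, are easy to enumerate. The injectivity
  -- required by `𝒫` becomes the decidable condition `Distinct`.
  Task : Set
  Task = Σ[ n ∈ ℕ⁺ ] Vec (Vec ℕ⁺ (value (r n))) (value n)

  ℕ↠Task : ℕ ↠ Task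
  ℕ↠Task = ℕ↠Σ ℕ↠ℕ⁺ λ n → ℕ↠Vec (ℕ↠Vec ℕ↠ℕ⁺ (value (r n))) (value n)

  Distinct : Task → Set
  Distinct (n , M) = ∀ i j → lookup M i ≡ lookup M j → i ≡ j

  distinct? : Decidable Distinct
  distinct? (n , M) = all? λ i → all? λ j →
    Vec.≡-dec (Refinement._≟_ _≟_) (lookup M i) (lookup M j) →-dec i Fin.≟ j

  Solves : ∀ {p} → Task → Pred (Pred ℕ⁺ p) p
  Solves (n , M) P = ∃[ x ] Σ[ H ∈ Subset _ ] Nonempty H × (∀ j → P (x +Σ[ H ] lookup M j))

  enumerated-by : ∀ ((n , M) : Task) → Distinct (n , M) → 𝒫 (value n) (Seq (value (r n)))
  enumerated-by (n , M) distinct = record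
    { to        = lookup M
    ; cong      = λ { refl → ≡⇒≋ refl }
    ; injective = λ eq → distinct _ _ (≋⇒≡ eq)
    }

  piece-for : ∀ t N → Σ[ xs ∈ List ℕ⁺ ]
    (∀ {s} → s ∈ xs → A s × N ≤ value s) × (Distinct t → Solves t (_∈ xs))
  piece-for t@(n , M) N with distinct? t
  -- A task with repetitions demands nothing, so its piece is empty.
  ... | no ¬distinct = [] , (λ ()) , λ distinct → contradiction distinct ¬distinct
  ... | yes distinct
    with x , H , H≢∅ , ⊆A ← rich⇒solution≥ rich n (enumerated-by t distinct) N =
    List.tabulate (λ j → x +Σ[ H ] lookup M j) ,
    (λ s∈ → ⊆A (∈-tabulate⁻ s∈)) ,
    (λ _ → x , H , H≢∅ , ∈-tabulate⁺)

  task : ℕ → Task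
  task i = Surjection.to ℕ↠Task (proj₁ (unpair i))

  mutual
    piece : ℕ → List ℕ⁺
    piece i = proj₁ (piece-for (task i) (start i))

    start : ℕ → ℕ
    start zero    = 0
    -- Joining with `start i` keeps the sequence strictly increasing even when the piece is empty.
    start (suc i) = suc (start i ⊔ max 0 (List.map value (piece i)))

  open Intervals start refl (λ i → s≤s (m≤m⊔n (start i) _))

  index : ℕ⁺ → ℕ
  index = locate ∘ value

  piece⊆A : ∀ i {s} → s ∈ piece i → A s
  piece⊆A i = proj₁ ∘ proj₁ (proj₂ (piece-for (task i) (start i)))

  index-piece : ∀ i {s} → s ∈ piece i → index s ≡ i
  index-piece i {s} s∈ = locate-unique
    ( proj₂ (proj₁ (proj₂ (piece-for (task i) (start i))) s∈)
    , s≤s (≤-trans (All.lookup (xs≤max 0 (List.map value (piece i))) (∈-map⁺ value s∈))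
                   (m≤n⊔m (start i) _)))

  piece-solves : ∀ i → Distinct (task i) → Solves (task i) (_∈ piece i)
  piece-solves i = proj₂ (proj₂ (piece-for (task i) (start i)))

  -- Any `L`, written as a vector, is the k-th task for some k, and the piece with label `c k`
  -- solves it. Thus `r` serves for `P` as well.
  ⊇pieces⇒rich : ∀ {p} {P : Pred ℕ⁺ p} (c : ℕ → ℕ) →
    (∀ k → (_∈ piece (pair (k , c k))) ⊆ P) → CombinatoriallyRich P
  ⊇pieces⇒rich {P = P} c ⊆P = r , λ n L →
    solve n L (Surjection.strictlySurjective ℕ↠Task (n , tabulate (Injection.to L)))
    where
    solve : ∀ n (L : 𝒫 (value n) (Seq (value (r n)))) →
      ∃[ k ] Surjection.to ℕ↠Task k ≡ (n , tabulate (Injection.to L)) →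
      ∃[ x ] Σ[ H ∈ Subset (value (r n)) ] Nonempty H × translate L x H ⊆ P
    solve n L (k , eq) =
      let x , H , H≢∅ , sums∈ = solution
      in x , H , H≢∅ , λ { (j , refl) → ⊆P k
           (subst (λ f → x +Σ[ H ] f ∈ piece i) (lookup∘tabulate (Injection.to L) j) (sums∈ j)) }
      where
      i = pair (k , c k)
      M = tabulate (Injection.to L)

      task≡ : task i ≡ (n , M)
      task≡ = trans (cong (Surjection.to ℕ↠Task ∘ proj₁) (unpair∘pair (k , c k))) eq

      distinct : Distinct (n , M)
      distinct j j′ eq = Injection.injective L (≡⇒≋
        (trans (sym (lookup∘tabulate (Injection.to L) j)) (trans eq (lookup∘tabulate (Injection.to L) j′))))

      solution : Solves (n , M) (_∈ piece i)
      solution = subst (λ t → Distinct t → Solves t (_∈ piece i)) task≡ (piece-solves i) distinct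

  -- The disjoint blocks

  colour : ℕ⁺ → ℕ
  colour = proj₂ ∘ unpair ∘ index

  -- The whole interval is coloured and not just its piece, so the blocks exhaust `A`.
  Block : ℕ → Pred ℕ⁺ ℓ
  Block c s = A s × colour s ≡ c

  block-rich : ∀ c → CombinatoriallyRich (Block c)
  block-rich c = ⊇pieces⇒rich (λ _ → c) λ k s∈ →
    piece⊆A (pair (k , c)) s∈ ,
    trans (cong (proj₂ ∘ unpair) (index-piece (pair (k , c)) s∈)) (cong proj₂ (unpair∘pair (k , c)))

  -- The almost disjoint branches

  OnBranch : (ℕ → Bool) → ℕ → Set
  OnBranch x i = prefix x (proj₁ (unpair i)) ≡ proj₂ (unpair i)

  -- Confining the branch to the pieces, which are finite lists, makes it decidable although `A` may
  -- not be.
  Branch : (ℕ → Bool) → Pred ℕ⁺ ℓ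
  Branch x s = A s × s ∈ piece (index s) × OnBranch x (index s)

  branch? : ∀ x → Decidable (Branch x)
  branch? x s = map′ (λ (s∈ , on) → piece⊆A (index s) s∈ , s∈ , on) proj₂
    ((s ∈? piece (index s)) ×-dec (prefix x (proj₁ (unpair (index s))) ≟ proj₂ (unpair (index s))))
    where open DecMembership (Refinement._≟_ _≟_) using (_∈?_)

  branch-rich : ∀ x → CombinatoriallyRich (Branch x)
  branch-rich x = ⊇pieces⇒rich (prefix x) λ k {s} s∈ →
    piece⊆A (pair (k , prefix x k)) s∈ ,
    subst (λ i → s ∈ piece i × OnBranch x i) (sym (index-piece (pair (k , prefix x k)) s∈))
      (s∈ , subst (λ (k , c) → prefix x k ≡ c) (sym (unpair∘pair (k , prefix x k))) refl)

  branch-cong : ∀ {x y} → (∀ k → x k ≡ y k) → Branch x ⊆ Branch y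
  branch-cong eq {s} (a , s∈ , on) =
    a , s∈ , trans (sym (prefix-cong eq (proj₁ (unpair (index s))))) on

  -- A common member lies in a piece ⟨k,c⟩ where c codes both x and y restricted to k. Hence k ≤ j,
  -- and the right ends of these finitely many intervals have a common bound.
  branch-∩-bounded : ∀ x y {j} → x j ≢ y j → ∃[ N ] (∀ {s} → (Branch x ∩ Branch y) s → value s < N)
  branch-∩-bounded x y {j} xj≢yj = proj₁ bound , below
    where
    bound : ∃[ N ] (∀ k → k < suc j → start (suc (pair (k , prefix x k))) ≤ N)
    bound = initial-values-bounded (λ k → start (suc (pair (k , prefix x k)))) (suc j)

    below : ∀ {s} → (Branch x ∩ Branch y) s → value s < proj₁ bound
    below {s} ((_ , _ , onx) , (_ , _ , ony)) = <-≤-trans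
      (proj₂ (locate-between (value s)))
      (subst (λ i → start (suc i) ≤ proj₁ bound) pair≡index (proj₂ bound k (s≤s k≤j)))
      where
      k = proj₁ (unpair (index s))

      pair≡index : pair (k , prefix x k) ≡ index s
      pair≡index = trans (cong (λ c → pair (k , c)) onx) (pair∘unpair (index s))

      k≤j : k ≤ j
      k≤j = ≮⇒≥ λ j<k → xj≢yj (prefix-injective k (trans onx (sym ony)) j<k)

  -- If x and y differed at j, the rich and hence unbounded `Branch x` would lie in a bounded
  -- intersection. Bits are decidable, so refuting the difference suffices.
  branch-injective : ∀ {x y} → Branch x ≐ Branch y → ∀ j → x j ≡ y j
  branch-injective {x} {y} (x⊆y , _) j = decidable-stable (x j Bool.≟ y j) λ xj≢yj →
    let N , <N       = branch-∩-bounded x y xj≢yj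
        s , bs , N≤s = rich⇒unbounded (branch-rich x) N
    in <⇒≱ (<N (bs , x⊆y bs)) N≤s

  branches : AlmostDisjointFamily 2^ω ℕ⁺-setoid ℓ
  branches = record
    { family = record
      { to        = Branch
      ; cong      = λ eq → branch-cong eq , branch-cong (sym ∘ eq)
      ; injective = branch-injective
      }
    ; equinumerous    = λ x → unbounded⇒equinumerous (branch? x) (rich⇒unbounded (branch-rich x))
    ; almost-disjoint = λ x y x≢y →
        record { to = proj₁ ; cong = λ eq → eq ; injective = λ eq → eq } ,
        -- An injection `g` into the intersection rules out a bound on it, so x and y agree at every
        -- j and the two branches coincide.
        λ g → let eq = λ j → decidable-stable (x j Bool.≟ y j) λ xj≢yj →
                    let N , <N = branch-∩-bounded x y xj≢yj in bounded⇒¬↣ N <N g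
              in x≢y (branch-cong eq , branch-cong (sym ∘ eq))
    }

theorem3p2 : ∀ {ℓ} (A : Pred ℕ⁺ ℓ) → CombinatoriallyRich A →
    (Σ[ F ∈ AlmostDisjointFamily 2^ω ℕ⁺-setoid ℓ ]
    (∀ x → AlmostDisjointFamily.member F x ⊆ A ×
    CombinatoriallyRich (AlmostDisjointFamily.member F x)))
    ×
    (Σ[ B ∈ (ℕ → Pred ℕ⁺ ℓ) ]
    A ≐ ⋃ ℕ B ×
    (∀ i j → i ≢ j → B i ⊥ B j) ×
    (∀ i → CombinatoriallyRich (B i)))
theorem3p2 A rich =
  (branches , λ x → proj₁ , branch-rich x) ,
  (Block ,
    ((λ a → _ , a , refl) , (λ (_ , a , _) → a)) ,
    (λ { i j i≢j ((_ , c≡i) , (_ , c≡j)) → i≢j (trans (sym c≡i) c≡j) }) ,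
    block-rich)
  where open Splitting rich
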